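{- Let $n$ and $k$ be integers with $2\leqslant k\leqslant n-1$. Then $$|\mathcal{F}_n^{k-1}[n\prec 1]|=n\,|\mathcal{F}_n^{k}[n\prec 1]|.$$
   Context: Write $[n]=\{1,\ldots,n\}$. For $1\leqslant k\leqslant n$, $\mathcal{F}_n^k$ denotes the set of forests with vertex set $[n]$ that consist of exactly $k$ rooted (non-plane, labeled) trees whose roots are $1,\ldots,k$ respectively. For a vertex $x$ of a forest $F$, $F_x$ denotes the subtree of $F$ rooted at $x$; a vertex $y$ is a descendant of $x$, written $y\prec x$, if $y$ is a vertex of $F_x$, i.e. $x$ lies on the path from the root of the tree containing $y$ to $y$. $\mathcal{F}_n^k[n\prec 1]$ denotes the subset of those forests in $\mathcal{F}_n^k$ in which $n\prec 1$, i.e. vertex $n$ lies in the tree rooted at $1$. -}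

module Defs where

open import Data.Bool.Base using (Bool; T)
open import Data.Fin.Base using (Fin; toℕ)
open import Data.List.Base using (List; []; _∷_; length)
open import Data.List.Membership.Propositional using (_∈_)
open import Data.List.Relation.Unary.Unique.Propositional using (Unique)
open import Data.Nat.Base using (ℕ; suc; _≤_)
open import Data.Product using (_×_; ∃; ∃₂; ∃!)
open import Data.Vec.Base using (Vec; lookup)
open import Function.Bundles using (_⇔_)
open import Level using (Level; _⊔_)
open import Relation.Binary.PropositionalEquality.Core using (_≡_)
open import Relation.Nullary.Negation.Core using (¬_)

private
  variable
    a p : Level
    n : ℕ

-- The vertex set [n] = {1,…,n} is Fin n, the vertex v carrying label toℕ v + 1.
label : Fin n → ℕ
label v = suc (toℕ v)

-- Adjacency matrices, so that two graphs are equal (_≡_) exactly when they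
-- have the same edges.
Graph : ℕ → Set
Graph n = Vec (Vec Bool n) n

Adj : Graph n → Fin n → Fin n → Set
Adj G u v = T (lookup (lookup G u) v)

record IsSimpleGraph (G : Graph n) : Set where
  field
    symmetric : ∀ u v → Adj G u v → Adj G v u
    loopless  : ∀ v → ¬ Adj G v v

-- Walk G u v vs: vs lists, in order, the vertices of a walk from u to v,
-- both endpoints included.
data Walk (G : Graph n) : Fin n → Fin n → List (Fin n) → Set where
  stop : ∀ {u} → Walk G u u (u ∷ [])
  step : ∀ {u v w vs} → Adj G u v → Walk G v w vs → Walk G u w (u ∷ vs)

Path : Graph n → Fin n → Fin n → List (Fin n) → Set
Path G u v vs = Walk G u v vs × Unique vs

Connected : Graph n → Fin n → Fin n → Set
Connected G u v = ∃ λ vs → Path G u v vs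

-- A cycle is a path on at least three vertices whose ends are adjacent.
IsCycle : Graph n → List (Fin n) → Set
IsCycle G vs = ∃₂ λ u v → Path G u v vs × 3 ≤ length vs × Adj G v u

Acyclic : Graph n → Set
Acyclic G = ∀ vs → ¬ IsCycle G vs

IsRoot : ℕ → Fin n → Set
IsRoot k v = label v ≤ k

-- 𝓕 n k, for 1 ≤ k ≤ n, as a predicate on graphs: since the roots are
-- prescribed, a rooted forest is determined by its underlying graph, and it
-- consists of k trees with roots 1,…,k exactly when every connected component
-- contains exactly one of the vertices 1,…,k.
record 𝓕 (n k : ℕ) (G : Graph n) : Set where
  field
    isSimpleGraph : IsSimpleGraph G
    acyclic       : Acyclic G
    uniqueRoot    : ∀ v → ∃! _≡_ λ r → IsRoot k r × Connected G r v

-- Descendant k G y x is y ≺ x: the vertex x lies on the path to y from the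
-- root of the tree containing y. In particular x ≺ x.
Descendant : ℕ → Graph n → Fin n → Fin n → Set
Descendant k G y x = ∃₂ λ r vs → IsRoot k r × Path G r y vs × x ∈ vs

𝓕[n≺1] : (n k : ℕ) → Graph n → Set
𝓕[n≺1] n k G =
  𝓕 n k G × ∃₂ λ y x → label y ≡ n × label x ≡ 1 × Descendant k G y x

-- The set {x | P x} is finite with exactly m elements.
HasCardinality : {A : Set a} → (A → Set p) → ℕ → Set (a ⊔ p)
HasCardinality P m =
  ∃ λ xs → Unique xs × (∀ x → x ∈ xs ⇔ P x) × length xs ≡ m

{-# OPTIONS --safe #-}

-- A forest F with roots 1,…,k−1 and n ≺ 1 is cut at the edge joining k to its
-- parent p, which makes k a root. Either n is still connected to 1, and F goes
-- to (F − kp , p); or n is now connected to k, which means that p is connected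
-- to 1, and F goes to (F − kp , p) with the labels 1 and k exchanged. The first
-- case yields the pairs (G , p) in which p is not connected to k, and the second
-- those in which it is, so F ↦ (G , p) is a bijection onto 𝓕[n≺1] n k × [n].
module Submission where

open import Data.Bool.Properties using (T-≡; ⇔→≡)
open import Data.Empty using (⊥-elim)
open import Data.Fin.Base using (Fin; zero; suc; toℕ; fromℕ; fromℕ<)
open import Data.Fin.Permutation.Components using (transpose)
open import Data.Fin.Properties using (_≟_; toℕ-injective; toℕ-fromℕ; toℕ-fromℕ<; toℕ<n)
open import Data.List.Base
  using (List; []; _∷_; length; map; cartesianProduct; allFin)
open import Data.List.Membership.Propositional using (_∈_; _∉_)
import Data.List.Membership.DecPropositional as DecMembership
open import Data.List.Membership.Propositional.Properties
  using (∈-cartesianProduct⁺; ∈-cartesianProduct⁻; ∈-allFin)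
open import Data.List.Properties using (length-++; length-map; length-tabulate)
open import Data.List.Relation.Unary.All using ([]; _∷_)
import Data.List.Relation.Unary.All as All
open import Data.List.Relation.Unary.All.Properties using (¬Any⇒All¬; All¬⇒¬Any)
open import Data.List.Relation.Unary.AllPairs using ([]; _∷_)
open import Data.List.Relation.Unary.Any using (here; there)
open import Data.List.Relation.Unary.Unique.Propositional using (Unique)
open import Data.List.Relation.Unary.Unique.Propositional.Properties
  using (cartesianProduct⁺; allFin⁺)
open import Data.Nat using (ℕ; zero; suc; _+_; _≤_; _<_; _∸_; _*_; z≤n; s≤s)
open import Data.Nat.Properties
  using ( ≤-reflexive; ≤-trans; <-irrefl; ≤∧≢⇒<; m≤n⇒m≤1+n; n≤1+n; *-comm
        ; suc-injective; m∸n+n≡m; +-suc; m≤n+m)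
import Data.Product as Product
open import Data.Product using (_×_; _,_; proj₁; proj₂; ∃; ∃₂; map₁; uncurry)
import Data.Sum as Sum
open import Data.Sum using (_⊎_; inj₁; inj₂; [_,_]′)
open import Data.Vec.Base using (Vec; lookup; tabulate)
open import Data.Vec.Properties
  using (lookup∘tabulate; tabulate∘lookup; tabulate-cong)
open import Function using (_∘_; id)
open import Function.Bundles using (_⇔_; mk⇔; Equivalence)
open import Function.Construct.Composition using (_⇔-∘_)
open import Function.Construct.Symmetry using (⇔-sym)
open import Level using (Level; _⊔_)
open import Relation.Binary.Construct.Closure.ReflexiveTransitive
  using (Star; ε; _◅_; _◅◅_; gmap; reverse)
import Relation.Binary.Construct.Closure.ReflexiveTransitive as Star
open import Relation.Binary.Definitions using (Decidable)
open import Relation.Binary.PropositionalEquality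
  using (_≡_; _≢_; refl; sym; trans; cong; cong₂; subst; subst₂; module ≡-Reasoning)
open import Relation.Nullary using (¬_; Dec; yes; no; contradiction; T?; ¬?; _×-dec_; _⊎-dec_)
open import Relation.Nullary.Decidable using (⌊_⌋; toWitness; fromWitness)
open import Defs

open Equivalence using (to; from)
open module FinMembership {n} = DecMembership (_≟_ {n}) using (_∈?_)

private
  variable
    a b p q r : Level
    A : Set a
    B : Set b
    n k m : ℕ
    G H : Graph n
    u v w x y c d : Fin n
    vs : List (Fin n)

-- Cardinalities

length-cartesianProduct : (xs : List A) (ys : List B) →
  length (cartesianProduct xs ys) ≡ length xs * length ys
length-cartesianProduct []       ys = refl
length-cartesianProduct (x ∷ xs) ys = trans (length-++ (map (x ,_) ys))
  (cong₂ _+_ (length-map (x ,_) ys) (length-cartesianProduct xs ys))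

HasCardinality-×-Fin : {P : A → Set p} → HasCardinality P m →
  HasCardinality {A = A × Fin n} (P ∘ proj₁) (n * m)
HasCardinality-×-Fin {m = m} {n = n} (xs , unique , complete , refl) =
  cartesianProduct xs (allFin n) ,
  cartesianProduct⁺ unique (allFin⁺ n) ,
  (λ (x , i) → mk⇔
    (to (complete x) ∘ proj₁ ∘ ∈-cartesianProduct⁻ xs (allFin n))
    (λ Px → ∈-cartesianProduct⁺ (from (complete x) Px) (∈-allFin i))) ,
  (begin
    length (cartesianProduct xs (allFin n)) ≡⟨ length-cartesianProduct xs (allFin n) ⟩
    m * length (allFin n)                   ≡⟨ cong (m *_) (length-tabulate {n = n} id) ⟩
    m * n                                   ≡⟨ *-comm m n ⟩
    n * m                                   ∎)
  where open ≡-Reasoning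

-- A relation takes the place of a map because the image of a pair depends on reachability, which
-- `reach?` decides only inside a forest.
record IsBijectionBetween {A : Set a} {B : Set b} (P : A → Set p) (Q : B → Set q)
                          (_∼_ : A → B → Set r) : Set (a ⊔ b ⊔ p ⊔ q ⊔ r) where
  field
    total      : ∀ {x} → P x → ∃ λ y → Q y × x ∼ y
    surjective : ∀ {y} → Q y → ∃ λ x → P x × x ∼ y
    functional : ∀ {x y y′} → x ∼ y → x ∼ y′ → y ≡ y′
    injective  : ∀ {x x′ y} → P x → P x′ → x ∼ y → x′ ∼ y → x ≡ x′

HasCardinality-bijection : {P : A → Set p} {Q : B → Set q} {_∼_ : A → B → Set r} →
  IsBijectionBetween P Q _∼_ → HasCardinality P m → HasCardinality Q m
HasCardinality-bijection {A = A} {B = B} {P = P} {Q = Q} {_∼_ = _∼_} bij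
                         (xs , unique , complete , refl) =
  let ys , unique′ , sound , hit , len = images xs (λ {x} → to (complete x)) unique
  in ys , unique′ ,
     (λ y → mk⇔ (λ y∈ → let _ , x∈ , Qy , _ = sound y∈ in Qy)
       (λ Qy → let x , Px , x∼y = surjective Qy in hit (from (complete x) Px) x∼y)) ,
     len
  where
  open IsBijectionBetween bij
  -- The list of images is built together with its two links to `xs`. The third component finds a
  -- preimage for every listed image, so a repetition would contradict injectivity; the fourth,
  -- resting on functionality, turns surjectivity into completeness.
  images : ∀ xs → (∀ {x} → x ∈ xs → P x) → Unique xs →
    ∃ λ ys → Unique ys × (∀ {y} → y ∈ ys → ∃ λ x → x ∈ xs × Q y × x ∼ y) ×
             (∀ {x y} → x ∈ xs → x ∼ y → y ∈ ys) × length ys ≡ length xs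
  images []       _   _ = [] , [] , (λ ()) , (λ ()) , refl
  images (x ∷ xs) all (x∉xs ∷ unique) =
    let y , Qy , x∼y = total (all (here refl))
        ys , unique′ , sound , hit , len = images xs (all ∘ there) unique
    in y ∷ ys ,
       ¬Any⇒All¬ ys (λ y∈ys → let x′ , x′∈ , _ , x′∼y = sound y∈ys in
         All.lookup x∉xs x′∈ (injective (all (here refl)) (all (there x′∈)) x∼y x′∼y))
         ∷ unique′ ,
       (λ { (here refl) → x , here refl , Qy , x∼y
          ; (there y∈)  → let x′ , x′∈ , rest = sound y∈ in x′ , there x′∈ , rest }) ,
       (λ { (here refl) x∼y′ → here (functional x∼y′ x∼y)
          ; (there x∈)  x∼y′ → there (hit x∈ x∼y′) }) ,
       cong suc len

-- Graphs and reachability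

-- Walks with their vertex lists forgotten, so that concatenation, reversal and transport come from
-- `Star`.
Reach : Graph n → Fin n → Fin n → Set
Reach G = Star (Adj G)

Adj-ext : (∀ u v → Adj G u v ⇔ Adj H u v) → G ≡ H
Adj-ext {G = G} {H = H} same = lookup-ext λ u → lookup-ext λ v →
  ⇔→≡ (T-≡ ⇔-∘ (same u v ⇔-∘ ⇔-sym T-≡))
  where
  lookup-ext : {xs ys : Vec A n} → (∀ i → lookup xs i ≡ lookup ys i) → xs ≡ ys
  lookup-ext {xs = xs} {ys = ys} eq =
    trans (sym (tabulate∘lookup xs)) (trans (tabulate-cong eq) (tabulate∘lookup ys))

fromDecidable : {E : Fin n → Fin n → Set} → Decidable E → Graph n
fromDecidable E? = tabulate λ u → tabulate λ v → ⌊ E? u v ⌋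

Adj-fromDecidable : {E : Fin n → Fin n → Set} (E? : Decidable E) →
  Adj (fromDecidable E?) u v ⇔ E u v
Adj-fromDecidable {u = u} {v = v} E?
  rewrite lookup∘tabulate (λ u → tabulate λ v → ⌊ E? u v ⌋) u
        | lookup∘tabulate (λ v → ⌊ E? u v ⌋) v
  = mk⇔ (toWitness {a? = E? u v}) (fromWitness {a? = E? u v})

Joins : (c d u v : Fin n) → Set
Joins c d u v = (u ≡ c × v ≡ d) ⊎ (u ≡ d × v ≡ c)

Joins? : (c d : Fin n) → Decidable (Joins c d)
Joins? c d u v = (u ≟ c ×-dec v ≟ d) ⊎-dec (u ≟ d ×-dec v ≟ c)

Joins-sym : Joins c d u v → Joins c d v u
Joins-sym (inj₁ (x , y)) = inj₂ (y , x)
Joins-sym (inj₂ (x , y)) = inj₁ (y , x)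

adj? : (G : Graph n) → Decidable (Adj G)
adj? G u v = T? (lookup (lookup G u) v)

addEdge deleteEdge : Graph n → Fin n → Fin n → Graph n
addEdge    G c d = fromDecidable λ u v → adj? G u v ⊎-dec Joins? c d u v
deleteEdge G c d = fromDecidable λ u v → adj? G u v ×-dec ¬? (Joins? c d u v)

-- Pulling back along `σ` avoids naming an inverse; for an involution it agrees with pushing
-- forward.
relabel : (Fin n → Fin n) → Graph n → Graph n
relabel σ G = fromDecidable λ u v → adj? G (σ u) (σ v)

Adj-addEdge : (G : Graph n) → Adj (addEdge G c d) u v ⇔ (Adj G u v ⊎ Joins c d u v)
Adj-addEdge {c = c} {d = d} G = Adj-fromDecidable λ u v → adj? G u v ⊎-dec Joins? c d u v

Adj-deleteEdge : (G : Graph n) →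
  Adj (deleteEdge G c d) u v ⇔ (Adj G u v × ¬ Joins c d u v)
Adj-deleteEdge {c = c} {d = d} G =
  Adj-fromDecidable λ u v → adj? G u v ×-dec ¬? (Joins? c d u v)

Adj-relabel : (σ : Fin n → Fin n) (G : Graph n) →
  Adj (relabel σ G) u v ⇔ Adj G (σ u) (σ v)
Adj-relabel σ G = Adj-fromDecidable λ u v → adj? G (σ u) (σ v)

-- A walk using the edge cd is cut at its first and last use of it.
Star-split : {E : Fin n → Fin n → Set} → Star (λ u v → E u v ⊎ Joins c d u v) u v →
  Star E u v ⊎ (Star E u c × Star E d v) ⊎ (Star E u d × Star E c v)
Star-split ε = inj₁ ε
Star-split (inj₁ e ◅ es) with Star-split es
... | inj₁ x              = inj₁ (e ◅ x)
... | inj₂ (inj₁ (x , y)) = inj₂ (inj₁ (e ◅ x , y))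
... | inj₂ (inj₂ (x , y)) = inj₂ (inj₂ (e ◅ x , y))
Star-split (inj₂ (inj₁ (refl , refl)) ◅ es) with Star-split es
... | inj₁ x              = inj₂ (inj₁ (ε , x))
... | inj₂ (inj₁ (_ , y)) = inj₂ (inj₁ (ε , y))
... | inj₂ (inj₂ (_ , y)) = inj₁ y
Star-split (inj₂ (inj₂ (refl , refl)) ◅ es) with Star-split es
... | inj₁ x              = inj₂ (inj₂ (ε , x))
... | inj₂ (inj₁ (_ , y)) = inj₁ y
... | inj₂ (inj₂ (_ , y)) = inj₂ (inj₂ (ε , y))

Reach-addEdge⁻ : (G : Graph n) → Reach (addEdge G c d) u v →
  Reach G u v ⊎ (Reach G u c × Reach G d v) ⊎ (Reach G u d × Reach G c v)
Reach-addEdge⁻ G = Star-split ∘ Star.map (to (Adj-addEdge G))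

Reach-addEdge⁺ : (G : Graph n) → Reach G u v → Reach (addEdge G c d) u v
Reach-addEdge⁺ G = Star.map (from (Adj-addEdge G) ∘ inj₁)

Reach-deleteEdge⁻ : (G : Graph n) → Reach (deleteEdge G c d) u v → Reach G u v
Reach-deleteEdge⁻ G = Star.map (proj₁ ∘ to (Adj-deleteEdge G))

deleteEdge-split : (G : Graph n) → Reach G u v → let D = deleteEdge G c d in
  Reach D u v ⊎ (Reach D u c × Reach D d v) ⊎ (Reach D u d × Reach D c v)
deleteEdge-split {c = c} {d = d} G = Star-split ∘ Star.map classify
  where
  classify : Adj G u v → Adj (deleteEdge G c d) u v ⊎ Joins c d u v
  classify {u} {v} e with Joins? c d u v
  ... | yes j = inj₂ j
  ... | no ¬j = inj₁ (from (Adj-deleteEdge G) (e , ¬j))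

-- Forests

-- Acyclicity is replaced by the condition that every edge is a bridge.
record IsForest {n} (R : Fin n → Set) (G : Graph n) : Set where
  field
    symmetric  : Adj G u v → Adj G v u
    loopless   : ¬ Adj G v v
    bridge     : Adj G u v → ¬ Reach (deleteEdge G u v) u v
    hasRoot    : ∀ v → ∃ λ r → R r × Reach G r v
    rootUnique : R u → R v → Reach G u v → u ≡ v

  reverse-Reach : Reach G u v → Reach G v u
  reverse-Reach = reverse symmetric

  -- No search is made: a root reaches `v` exactly when it is the root that `hasRoot` assigns to
  -- `v`.
  reach? : R u → ∀ v → Dec (Reach G u v)
  reach? {u} Ru v with hasRoot v
  ... | r , Rr , r⇝v with r ≟ u
  ...   | yes refl = yes r⇝v
  ...   | no r≢u   = no λ u⇝v → r≢u (rootUnique Rr Ru (r⇝v ◅◅ reverse-Reach u⇝v))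

open IsForest

-- Adding and deleting an edge at `c`, where `R′` is `R` without the root `c`

module _ {R R′ : Fin n → Set} {c : Fin n}
         (R′⇒ : ∀ {v} → R′ v → R v × v ≢ c) (⇒R′ : ∀ {v} → R v → v ≢ c → R′ v)
         (Rc : R c) where

  -- The tree of `c` is hung below `d`, which lies in another tree. A detour around any edge would
  -- yield a walk in `G` between `c` and `d`.
  addEdge-isForest : IsForest R G → ¬ Reach G c d → IsForest R′ (addEdge G c d)
  addEdge-isForest {G} {d} F c↛d = record
    { symmetric  = λ e → from (Adj-addEdge G)
        ([ inj₁ ∘ symmetric F , inj₂ ∘ Joins-sym ]′ (to (Adj-addEdge G) e))
    ; loopless   = λ e →
        [ loopless F
        , (λ { (inj₁ (refl , refl)) → c↛d ε ; (inj₂ (refl , refl)) → c↛d ε }) ]′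
        (to (Adj-addEdge G) e)
    ; bridge     = bridge′
    ; hasRoot    = hasRoot′
    ; rootUnique = rootUnique′
    }
    where
    separated : ¬ Reach G d c
    separated = c↛d ∘ reverse-Reach F

    bridge′ : Adj (addEdge G c d) u v → ¬ Reach (deleteEdge (addEdge G c d) u v) u v
    bridge′ {u} {v} e w = [ oldEdge , newEdge ]′ (to (Adj-addEdge G) e)
      where
      edges : Adj (deleteEdge (addEdge G c d) u v) x y →
        (Adj G x y ⊎ Joins c d x y) × ¬ Joins u v x y
      edges = map₁ (to (Adj-addEdge G)) ∘ to (Adj-deleteEdge (addEdge G c d))

      newEdge : ¬ Joins c d u v
      newEdge (inj₁ (refl , refl)) =
        c↛d (Star.map (λ e → [ id , ⊥-elim ∘ proj₂ (edges e) ]′ (proj₁ (edges e))) w)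
      newEdge (inj₂ (refl , refl)) =
        separated (Star.map (λ e →
          [ id , ⊥-elim ∘ proj₂ (edges e) ∘ Sum.swap ]′ (proj₁ (edges e))) w)

      oldEdge : ¬ Adj G u v
      -- A detour around `uv` that uses `cd` leaves walks in `G` from `u` and `v` to the two ends of
      -- `cd`; together with the edge `uv` they connect `c` and `d` in `G`.
      oldEdge g with Star-split (Star.map (λ e →
        Sum.map₁ (λ h → from (Adj-deleteEdge G) (h , proj₂ (edges e))) (proj₁ (edges e))) w)
      ... | inj₁ x              = bridge F g x
      ... | inj₂ (inj₁ (x , y)) =
        c↛d (reverse-Reach F (Reach-deleteEdge⁻ G x) ◅◅ g ◅ reverse-Reach F (Reach-deleteEdge⁻ G y))
      ... | inj₂ (inj₂ (x , y)) =
        separated (reverse-Reach F (Reach-deleteEdge⁻ G x) ◅◅ g ◅ reverse-Reach F (Reach-deleteEdge⁻ G y))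

    hasRoot′ : ∀ v → ∃ λ r → R′ r × Reach (addEdge G c d) r v
    hasRoot′ v with hasRoot F v
    ... | r , Rr , r⇝v with r ≟ c
    ...   | no r≢c   = r , ⇒R′ Rr r≢c , Reach-addEdge⁺ G r⇝v
    ...   | yes refl =
      -- The former tree of `c` inherits the root `s` of `d`, reached through the new edge.
      let s , Rs , s⇝d = hasRoot F d
      in s , ⇒R′ Rs (λ { refl → c↛d s⇝d }) ,
         (Reach-addEdge⁺ G s⇝d ◅◅ from (Adj-addEdge G) (inj₂ (inj₂ (refl , refl)))
                               ◅ Reach-addEdge⁺ G r⇝v)

    rootUnique′ : R′ u → R′ v → Reach (addEdge G c d) u v → u ≡ v
    rootUnique′ R′u R′v u⇝v with R′⇒ R′u | R′⇒ R′v | Reach-addEdge⁻ G u⇝v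
    ... | Ru , u≢c | Rv , v≢c | inj₁ x              = rootUnique F Ru Rv x
    -- If the walk uses `cd`, one of its two pieces connects `c` in `G` to a root other than `c`.
    ... | Ru , u≢c | Rv , v≢c | inj₂ (inj₁ (x , _)) = contradiction (rootUnique F Ru Rc x) u≢c
    ... | Ru , u≢c | Rv , v≢c | inj₂ (inj₂ (_ , y)) =
      contradiction (sym (rootUnique F Rc Rv y)) v≢c

  -- The tree containing `cd` falls into the part of `d`, which keeps the root `w`, and the part of
  -- `c`, which gets `c` as its root. The parts are separate because `cd` is a bridge.
  deleteEdge-isForest : IsForest R′ G → Adj G c d → R′ w → Reach (deleteEdge G c d) w d →
    IsForest R (deleteEdge G c d)
  deleteEdge-isForest {G} {d} {w} F cd R′w w⇝d = record
    { symmetric  = sym′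
    ; loopless   = loopless F ∘ proj₁ ∘ to (Adj-deleteEdge G)
    ; bridge     = λ {u} {v} e x → bridge F (proj₁ (to (Adj-deleteEdge G) e))
        (Star.map (λ f → let g , ¬uv = to (Adj-deleteEdge D) f in
          from (Adj-deleteEdge G) (proj₁ (to (Adj-deleteEdge G) g) , ¬uv)) x)
    ; hasRoot    = hasRoot′
    ; rootUnique = rootUnique′
    }
    where
    D = deleteEdge G c d

    sym′ : Adj D u v → Adj D v u
    sym′ e = let g , ¬j = to (Adj-deleteEdge G) e in
      from (Adj-deleteEdge G) (symmetric F g , ¬j ∘ Joins-sym)

    c↛w : ¬ Reach D c w
    c↛w x = bridge F cd (x ◅◅ w⇝d)

    hasRoot′ : ∀ v → ∃ λ r → R r × Reach D r v
    hasRoot′ v with hasRoot F v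
    ... | r , R′r , r⇝v with deleteEdge-split G r⇝v
    ...   | inj₁ x              = r , proj₁ (R′⇒ R′r) , x
    ...   | inj₂ (inj₁ (_ , y)) = w , proj₁ (R′⇒ R′w) , (w⇝d ◅◅ y)
    ...   | inj₂ (inj₂ (_ , y)) = c , Rc , y

    -- Through `cd`, such a root `v` would be connected in `G` to `w`, hence equal to `w`, which is
    -- out of reach of `c` in `D`.
    onlyRoot : R v → ¬ v ≡ c → ¬ Reach D c v
    onlyRoot Rv v≢c x with rootUnique F (⇒R′ Rv v≢c) R′w
      (reverse-Reach F (Reach-deleteEdge⁻ G x) ◅◅ cd ◅ reverse-Reach F (Reach-deleteEdge⁻ G w⇝d))
    ... | refl = c↛w x

    rootUnique′ : R u → R v → Reach D u v → u ≡ v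
    rootUnique′ {u} {v} Ru Rv x with u ≟ c | v ≟ c
    ... | yes refl | yes refl = refl
    ... | yes refl | no v≢c   = contradiction x (onlyRoot Rv v≢c)
    ... | no u≢c   | yes refl = contradiction (reverse sym′ x) (onlyRoot Ru u≢c)
    ... | no u≢c   | no v≢c   =
      rootUnique F (⇒R′ Ru u≢c) (⇒R′ Rv v≢c) (Reach-deleteEdge⁻ G x)

  -- If u ≢ v then cu is an edge of H, while the walk in G to u from its root s
  -- avoids c and so survives in H: there the roots s and c would be connected.
  addEdge-injective : IsForest R G → IsForest R H → ¬ Reach G c u → ¬ Reach H c v →
    addEdge G c u ≡ addEdge H c v → G ≡ H × u ≡ v
  addEdge-injective {G} {H} {u} {v} F F′ c↛u c↛v eq with u ≟ v
  ... | yes refl = Adj-ext {G = G} {H = H} (λ x y → mk⇔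
      (half {H = H} F c↛u eq) (half {H = G} F′ c↛v (sym eq))) , refl
    where
    -- An edge of `G` is never the added edge `cu`, since `c` does not reach `u` in `G`; so it must
    -- come from `H`.
    half : ∀ {G H} → IsForest R G → ¬ Reach G c u → addEdge G c u ≡ addEdge H c u →
      Adj G x y → Adj H x y
    half {x} {y} {G} {H} F c↛u eq e
      with to (Adj-addEdge H) (subst (λ K → Adj K x y) eq (from (Adj-addEdge G) (inj₁ e)))
    ... | inj₁ h                    = h
    ... | inj₂ (inj₁ (refl , refl)) = contradiction (e ◅ ε) c↛u
    ... | inj₂ (inj₂ (refl , refl)) = contradiction (symmetric F e ◅ ε) c↛u
  ... | no u≢v = contradiction (s⇝u ◅◅ symmetric F′ cu ◅ ε) s↛c
    where
    toH : Adj (addEdge G c u) x y → Adj H x y ⊎ Joins c v x y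
    toH {x} {y} e = to (Adj-addEdge H) (subst (λ K → Adj K x y) eq e)

    cu : Adj H c u
    cu with toH (from (Adj-addEdge G) (inj₂ (inj₁ (refl , refl))))
    ... | inj₁ h                 = h
    ... | inj₂ (inj₁ (_ , refl)) = contradiction refl u≢v
    ... | inj₂ (inj₂ (refl , _)) = contradiction ε c↛v

    s = proj₁ (hasRoot F u)
    Rs = proj₁ (proj₂ (hasRoot F u))

    awayFrom : Reach G x u → Reach H x u
    awayFrom ε = ε
    awayFrom (e ◅ es) with toH (from (Adj-addEdge G) (inj₁ e))
    ... | inj₁ h                 = h ◅ awayFrom es
    ... | inj₂ (inj₁ (refl , _)) = contradiction (e ◅ es) c↛u
    ... | inj₂ (inj₂ (_ , refl)) = contradiction es c↛u

    s⇝u : Reach H s u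
    s⇝u = awayFrom (proj₂ (proj₂ (hasRoot F u)))

    s↛c : ¬ Reach H s c
    s↛c x with rootUnique F′ Rs Rc x
    ... | refl = c↛u (proj₂ (proj₂ (hasRoot F u)))

addEdge-deleteEdge : {R : Fin n → Set} → IsForest R G → Adj G c d →
  addEdge (deleteEdge G c d) c d ≡ G
addEdge-deleteEdge {G = G} {c} {d} F cd =
  Adj-ext {G = addEdge (deleteEdge G c d) c d} {H = G} λ u v → mk⇔
    ([ proj₁ ∘ to (Adj-deleteEdge G)
     , (λ { (inj₁ (refl , refl)) → cd ; (inj₂ (refl , refl)) → symmetric F cd }) ]′
     ∘ to (Adj-addEdge (deleteEdge G c d)))
    (λ e → from (Adj-addEdge (deleteEdge G c d)) (restore e (Joins? c d u v)))
  where
  restore : Adj G u v → Dec (Joins c d u v) → Adj (deleteEdge G c d) u v ⊎ Joins c d u v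
  restore e (yes j) = inj₂ j
  restore e (no ¬j) = inj₁ (from (Adj-deleteEdge G) (e , ¬j))

-- The vertex `d` comes just before the first arrival of the walk at `c`. The walk up to `d` avoids
-- `c`, so it survives the deletion.
findParent : {R : Fin n → Set} → IsForest R G → u ≢ c → Reach G u c →
  ∃ λ d → Adj G c d × Reach (deleteEdge G c d) u d
findParent F u≢c ε = contradiction refl u≢c
findParent {G = G} {c = c} F u≢c (_◅_ {j = v} e es) with v ≟ c
... | yes refl = _ , symmetric F e , ε
... | no v≢c   =
  let d , cd , v⇝d = findParent F v≢c es
  in d , cd ,
     (from (Adj-deleteEdge G)
       (e , λ { (inj₁ (u≡c , _)) → u≢c u≡c ; (inj₂ (_ , v≡c)) → v≢c v≡c }) ◅ v⇝d)

-- Relabelling by an involution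

module _ {σ : Fin n → Fin n} (σσ : ∀ v → σ (σ v) ≡ v) where

  relabel-involutive : (G : Graph n) → relabel σ (relabel σ G) ≡ G
  relabel-involutive G = Adj-ext {G = relabel σ (relabel σ G)} {H = G} λ u v → mk⇔
    (subst₂ (Adj G) (σσ u) (σσ v) ∘ to (Adj-relabel σ G) ∘ to (Adj-relabel σ (relabel σ G)))
    (from (Adj-relabel σ (relabel σ G)) ∘ from (Adj-relabel σ G)
      ∘ subst₂ (Adj G) (sym (σσ u)) (sym (σσ v)))

  Reach-relabel⁻ : (G : Graph n) → Reach (relabel σ G) u v → Reach G (σ u) (σ v)
  Reach-relabel⁻ G = gmap σ (to (Adj-relabel σ G))

  Reach-relabel⁺ : (G : Graph n) → Reach G u v → Reach (relabel σ G) (σ u) (σ v)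
  Reach-relabel⁺ G = gmap σ λ {x} {y} →
    from (Adj-relabel σ G) ∘ subst₂ (Adj G) (sym (σσ x)) (sym (σσ y))

  σ-injective : σ u ≡ σ v → u ≡ v
  σ-injective {u} {v} eq = trans (sym (σσ u)) (trans (cong σ eq) (σσ v))

  relabel-isForest : {R : Fin n → Set} → (∀ {v} → R v → R (σ v)) →
    IsForest R G → IsForest R (relabel σ G)
  relabel-isForest {G} {R} Rσ F = record
    { symmetric  = from (Adj-relabel σ G) ∘ symmetric F ∘ to (Adj-relabel σ G)
    ; loopless   = loopless F ∘ to (Adj-relabel σ G)
    -- By injectivity of `σ`, a detour avoiding `uv` is carried to one avoiding the edge between
    -- `σ u` and `σ v`.
    ; bridge     = λ e x → bridge F (to (Adj-relabel σ G) e)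
        (gmap σ (λ f → let g , ¬j = to (Adj-deleteEdge (relabel σ G)) f in
          from (Adj-deleteEdge G) (to (Adj-relabel σ G) g , ¬j ∘ Joins-σ)) x)
    ; hasRoot    = λ v → let r , Rr , r⇝ = hasRoot F (σ v) in
        σ r , Rσ Rr , subst (Reach (relabel σ G) (σ r)) (σσ v) (Reach-relabel⁺ G r⇝)
    ; rootUnique = λ Ru Rv x →
        σ-injective (rootUnique F (Rσ Ru) (Rσ Rv) (Reach-relabel⁻ G x))
    }
    where
    Joins-σ : Joins (σ c) (σ d) (σ u) (σ v) → Joins c d u v
    Joins-σ = Sum.map (Product.map σ-injective σ-injective)
                      (Product.map σ-injective σ-injective)

-- Walks, paths and cycles

Walk⇒Reach : Walk G u v vs → Reach G u v
Walk⇒Reach stop       = ε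
Walk⇒Reach (step e w) = e ◅ Walk⇒Reach w

Path-from : Path G u v vs → x ∈ vs → Connected G x v
Path-from p@(stop , _)            (here refl) = _ , p
Path-from p@(step _ _ , _)        (here refl) = _ , p
Path-from   (step _ w , _ ∷ uniq) (there x∈)  = Path-from (w , uniq) x∈

Reach⇒Connected : Reach G u v → Connected G u v
Reach⇒Connected ε = _ , stop , [] ∷ []
Reach⇒Connected {u = u} (e ◅ es) with Reach⇒Connected es
... | vs , w , uniq with u ∈? vs
-- Loop erasure: the path already found visits `u`, so it is restarted there.
...   | yes u∈ = Path-from (w , uniq) u∈
...   | no u∉  = _ , step e w , ¬Any⇒All¬ vs u∉ ∷ uniq

source∈ : Walk G u v vs → u ∈ vs
source∈ stop       = here refl
source∈ (step _ _) = here refl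

target∈ : Walk G u v vs → v ∈ vs
target∈ stop       = here refl
target∈ (step _ w) = there (target∈ w)

Path-to : Path G u v vs → x ∈ vs → Reach G u x
Path-to (stop , _)            (here refl) = ε
Path-to (step _ _ , _)        (here refl) = ε
Path-to (step e w , _ ∷ uniq) (there x∈)  = e ◅ Path-to (w , uniq) x∈

Walk-avoiding : Walk G u v vs → c ∉ vs → Reach (deleteEdge G c d) u v
Walk-avoiding stop c∉ = ε
Walk-avoiding {G = G} (step e w) c∉ =
  from (Adj-deleteEdge G)
    (e , λ { (inj₁ (refl , _)) → c∉ (here refl)
           ; (inj₂ (_ , refl)) → c∉ (there (source∈ w)) })
  ◅ Walk-avoiding w (c∉ ∘ there)

-- The path itself is the detour: its first edge leads to a vertex other than `v`, as there is a
-- third vertex, and the rest never returns to `u`.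
cycle⇒¬bridge : Path G u v vs → 3 ≤ length vs → Reach (deleteEdge G u v) u v
cycle⇒¬bridge (stop , _) (s≤s ())
cycle⇒¬bridge (step _ stop , _) (s≤s (s≤s ()))
cycle⇒¬bridge {G = G} (step e w@(step _ w′) , u∉ ∷ x∉ ∷ _) _ =
  from (Adj-deleteEdge G)
    (e , λ { (inj₁ (_ , refl)) → All¬⇒¬Any x∉ (target∈ w′)
           ; (inj₂ (_ , refl)) → All¬⇒¬Any u∉ (here refl) })
  ◅ Walk-avoiding w (All¬⇒¬Any u∉)

-- The detour is reduced to a path. This path has a third vertex, because a single step from `u` to
-- `v` would be the deleted edge.
¬bridge⇒cycle : Adj G v u → u ≢ v → Reach (deleteEdge G u v) u v → ∃ (IsCycle G)
¬bridge⇒cycle {G = G} {v = v} {u = u} vu u≢v x with Reach⇒Connected x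
... | vs , w , uniq = vs , u , v , (Walk-map w , uniq) , long w , vu
  where
  Walk-map : ∀ {c d vs} → Walk (deleteEdge G u v) c d vs → Walk G c d vs
  Walk-map stop       = stop
  Walk-map (step e w) = step (proj₁ (to (Adj-deleteEdge G) e)) (Walk-map w)

  long : ∀ {vs} → Walk (deleteEdge G u v) u v vs → 3 ≤ length vs
  long stop                       = contradiction refl u≢v
  long (step e stop)              =
    contradiction (inj₁ (refl , refl)) (proj₂ (to (Adj-deleteEdge G) e))
  long (step _ (step _ stop))       = s≤s (s≤s (s≤s z≤n))
  long (step _ (step _ (step _ _))) = s≤s (s≤s (s≤s z≤n))

-- A cycle is an edge together with a detour around it, so acyclicity and the bridge condition
-- agree. From here on duplicate-free paths give way to reachability.
𝓕⇔IsForest : 𝓕 n k G ⇔ IsForest (IsRoot k) G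
𝓕⇔IsForest {n} {k} {G} = mk⇔ forth back
  where
  forth : 𝓕 n k G → IsForest (IsRoot k) G
  forth F = record
    { symmetric  = λ {u} {v} → S.symmetric u v
    ; loopless   = λ {v} → S.loopless v
    ; bridge     = λ {u} {v} e x → uncurry (F.acyclic)
        (¬bridge⇒cycle (S.symmetric u v e) (λ { refl → S.loopless u e }) x)
    ; hasRoot    = λ v → let r , (Rr , _ , w , _) , _ = F.uniqueRoot v in
        r , Rr , Walk⇒Reach w
    ; rootUnique = λ {u} {v} Ru Rv x →
        let _ , _ , unique = F.uniqueRoot v in
        trans (sym (unique (Ru , Reach⇒Connected x))) (unique (Rv , Reach⇒Connected ε))
    }
    where
    module F = 𝓕 F
    module S = IsSimpleGraph F.isSimpleGraph

  back : IsForest (IsRoot k) G → 𝓕 n k G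
  back F = record
    { isSimpleGraph = record
      { symmetric = λ _ _ → symmetric F
      ; loopless  = λ _ → loopless F
      }
    ; acyclic       = λ { _ (u , v , path , 3≤ , vu) →
        bridge F (symmetric F vu) (cycle⇒¬bridge path 3≤) }
    ; uniqueRoot    = λ v → let r , Rr , x = hasRoot F v in
        r , (Rr , Reach⇒Connected x) , λ (Rs , _ , w , _) →
          rootUnique F Rr Rs (x ◅◅ reverse-Reach F (Walk⇒Reach w))
    }

label-injective : label u ≡ label v → u ≡ v
label-injective = toℕ-injective ∘ suc-injective

module _ {j : ℕ} {c : Fin n} (c≡j : toℕ c ≡ j) where

  -- Labels start at 1, so the vertex `c` of index `j` has label `suc j` and is the last of `suc j`
  -- roots. This and the next two lemmas supply the module hypotheses on `R`, `R′` and `c` for the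
  -- edge operations.
  IsRoot-suc : IsRoot j v → IsRoot (suc j) v × v ≢ c
  IsRoot-suc v≤j = m≤n⇒m≤1+n v≤j , λ { refl → <-irrefl c≡j v≤j }

  IsRoot-pred : IsRoot (suc j) v → v ≢ c → IsRoot j v
  IsRoot-pred (s≤s v≤j) v≢c =
    ≤∧≢⇒< v≤j (λ v≡j → v≢c (toℕ-injective (trans v≡j (sym c≡j))))

  IsRoot-last : IsRoot (suc j) c
  IsRoot-last = s≤s (≤-reflexive c≡j)

module _ {o z : Fin n} (o≡1 : label o ≡ 1) (z≡n : label z ≡ n) where

  𝓕[n≺1]⇔Reach : 1 ≤ k → 𝓕[n≺1] n k G ⇔ (IsForest (IsRoot k) G × Reach G o z)
  𝓕[n≺1]⇔Reach {k = k} {G = G} 1≤k = mk⇔ forth back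
    where
    Ro : IsRoot k o
    Ro = ≤-trans (≤-reflexive o≡1) 1≤k

    forth : 𝓕[n≺1] n k G → IsForest (IsRoot k) G × Reach G o z
    forth (F , y , x , y≡n , x≡1 , r , vs , Rr , path , x∈)
      with label-injective (trans y≡n (sym z≡n)) | label-injective (trans x≡1 (sym o≡1))
    -- As `o` is itself a root and lies on a path from the root `r`, it must be `r`.
    ... | refl | refl with rootUnique (to 𝓕⇔IsForest F) Rr Ro (Path-to path x∈)
    ...   | refl = to 𝓕⇔IsForest F , Walk⇒Reach (proj₁ path)

    back : IsForest (IsRoot k) G × Reach G o z → 𝓕[n≺1] n k G
    back (F , x) = let vs , path = Reach⇒Connected x in
      from 𝓕⇔IsForest F , z , o , z≡n , o≡1 , o , vs , Ro , path , source∈ (proj₁ path)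

  -- c is the vertex labelled k = suc j, the root lost on passing to k ∸ 1 roots.
  module _ {j : ℕ} {c : Fin n} (1≤j : 1 ≤ j) (j<n : suc j < n) (c≡j : toℕ c ≡ j) where

    private
      R R′ : Fin n → Set
      R  = IsRoot (suc j)
      R′ = IsRoot j

      σ : Fin n → Fin n
      σ = transpose o c

      R′⇒ : R′ v → R v × v ≢ c
      R′⇒ = IsRoot-suc c≡j

      ⇒R′ : R v → v ≢ c → R′ v
      ⇒R′ = IsRoot-pred c≡j

      Rc : R c
      Rc = IsRoot-last c≡j

    R′o : R′ o
    R′o = ≤-trans (≤-reflexive o≡1) 1≤j

    Ro : R o
    Ro = m≤n⇒m≤1+n R′o

    o≢c : o ≢ c
    o≢c = proj₂ (R′⇒ R′o)

    -- With `suc j < n` the vertex `z` differs from both `o` and `c`, so exchanging these two leaves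
    -- `z` in place.
    notRoot : ¬ R z
    notRoot Rz = <-irrefl refl (≤-trans j<n (≤-trans (≤-reflexive (sym z≡n)) Rz))

    σo≡c : σ o ≡ c
    σo≡c with o ≟ o
    ... | yes _  = refl
    ... | no o≢o = contradiction refl o≢o

    σc≡o : σ c ≡ o
    σc≡o with c ≟ o
    ... | yes c≡o = contradiction (sym c≡o) o≢c
    ... | no _ with c ≟ c
    ...   | yes _  = refl
    ...   | no c≢c = contradiction refl c≢c

    σ-fixes : v ≢ o → v ≢ c → σ v ≡ v
    σ-fixes {v} v≢o v≢c with v ≟ o
    ... | yes v≡o = contradiction v≡o v≢o
    ... | no _ with v ≟ c
    ...   | yes v≡c = contradiction v≡c v≢c
    ...   | no _    = refl

    σz≡z : σ z ≡ z
    σz≡z = σ-fixes (λ { refl → notRoot Ro }) (λ { refl → notRoot Rc })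

    -- The case analysis of the transposition is done once, for a property of a vertex and its
    -- image.
    σ-elim : (P : Fin n → Fin n → Set) → P o c → P c o →
      (∀ {v} → v ≢ o → v ≢ c → P v v) → ∀ v → P v (σ v)
    σ-elim P Poc Pco Pvv v = cases (v ≟ o) (v ≟ c)
      where
      cases : Dec (v ≡ o) → Dec (v ≡ c) → P v (σ v)
      cases (yes refl) _          = subst (P o) (sym σo≡c) Poc
      cases (no _)     (yes refl) = subst (P c) (sym σc≡o) Pco
      cases (no v≢o)   (no v≢c)   = subst (P v) (sym (σ-fixes v≢o v≢c)) (Pvv v≢o v≢c)

    σσ : ∀ v → σ (σ v) ≡ v
    σσ = σ-elim (λ v w → σ w ≡ v) σc≡o σo≡c σ-fixes

    Rσ : R v → R (σ v)
    Rσ {v} = σ-elim (λ v w → R v → R w) (λ _ → Rc) (λ _ → Ro) (λ _ _ → id) v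

    infix 4 _∼_

    -- This undoes the cut. When `p` lies in the tree of `c`, the edge `cp` would not join two
    -- trees; exchanging `o` and `c` first places `σ p` in the tree of `o`.
    _∼_ : Graph n × Fin n → Graph n → Set
    (G , p) ∼ F = (¬ Reach G c p × F ≡ addEdge G c p)
                ⊎ (Reach G c p × F ≡ addEdge (relabel σ G) c (σ p))

    private
      Marked : Graph n × Fin n → Set
      Marked (G , _) = IsForest R G × Reach G o z

      Cut : Graph n → Set
      Cut F = IsForest R′ F × Reach F o z

    relabel-forest : IsForest R G → IsForest R (relabel σ G)
    relabel-forest = relabel-isForest σσ Rσ

    c↛o : IsForest R G → ¬ Reach G c o
    c↛o F x = o≢c (sym (rootUnique F Rc Ro x))

    -- The exchange turns the tree of `c` into that of `o`, so `σ u` now belongs to `o`. Undoing it,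
    -- a walk from `c` to `σ u` would connect the roots `c` and `o` in `G`.
    relabel-separates : IsForest R G → Reach G c u → ¬ Reach (relabel σ G) c (σ u)
    relabel-separates {G = G} {u = u} F c⇝u x =
      c↛o F (c⇝u ◅◅ reverse-Reach F
        (subst₂ (Reach G) σc≡o (σσ u) (Reach-relabel⁻ σσ G x)))

    total : ∀ {x} → Marked x → ∃ λ F → Cut F × x ∼ F
    total {G , p} (F , o⇝z) with reach? F Rc p
    ... | no c↛p  = addEdge G c p ,
      (addEdge-isForest R′⇒ ⇒R′ Rc F c↛p , Reach-addEdge⁺ G o⇝z) , inj₁ (c↛p , refl)
    ... | yes c⇝p = addEdge σG c (σ p) ,
      ( addEdge-isForest R′⇒ ⇒R′ Rc (relabel-forest F) (relabel-separates F c⇝p)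
      -- The walk runs from `o` to `σ p`, over the new edge to `c`, and on to `z`; its outer pieces
      -- are the relabelled walks from `c` to `p` and from `o` to `z`.
      , (Reach-addEdge⁺ σG (subst (λ v → Reach σG v (σ p)) σc≡o (Reach-relabel⁺ σσ G c⇝p))
         ◅◅ from (Adj-addEdge σG) (inj₂ (inj₂ (refl , refl)))
         ◅ Reach-addEdge⁺ σG (subst₂ (Reach σG) σo≡c σz≡z (Reach-relabel⁺ σσ G o⇝z)))
      ) , inj₂ (c⇝p , refl)
      where σG = relabel σ G

    surjective : ∀ {F} → Cut F → ∃ λ x → Marked x × x ∼ F
    surjective {F} (forest , o⇝z) with hasRoot forest c
    ... | r , R′r , r⇝c with findParent forest (proj₂ (R′⇒ R′r)) r⇝c
    ...   | p , cp , r⇝p with deleteEdge-isForest R′⇒ ⇒R′ Rc forest cp R′r r⇝p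
                            | addEdge-deleteEdge forest cp
                            | deleteEdge-split {c = c} {d = p} F o⇝z
    ...     | forest′ | eq | inj₁ o⇝z′ =
      (D , p) , (forest′ , o⇝z′) , inj₁ (bridge forest cp , sym eq)
      where D = deleteEdge F c p
    -- Crossing from `c` to `p` is impossible: `o` would reach the other root `c` in the cut forest.
    ...     | forest′ | eq | inj₂ (inj₁ (o⇝c , _)) =
      contradiction (reverse-Reach forest′ o⇝c) (c↛o forest′)
    ...     | forest′ | eq | inj₂ (inj₂ (o⇝p , c⇝z)) =
      -- Since `_∼_` relabels before adding the edge, both the graph and the mark are given
      -- relabelled, and the two exchanges cancel.
      (relabel σ D , σ p) ,
      ( relabel-forest forest′
      , subst₂ (Reach (relabel σ D)) σc≡o σz≡z (Reach-relabel⁺ σσ D c⇝z)) ,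
      inj₂ ( subst (λ v → Reach (relabel σ D) v (σ p)) σo≡c (Reach-relabel⁺ σσ D o⇝p)
           , trans (sym eq) (cong₂ (λ K v → addEdge K c v)
               (sym (relabel-involutive σσ D)) (sym (σσ p))))
      where D = deleteEdge F c p

    functional : ∀ x {F F′} → x ∼ F → x ∼ F′ → F ≡ F′
    functional _ (inj₁ (_ , refl))   (inj₁ (_ , refl))   = refl
    functional _ (inj₁ (c↛p , _))    (inj₂ (c⇝p , _))    = contradiction c⇝p c↛p
    functional _ (inj₂ (c⇝p , _))    (inj₁ (c↛p , _))    = contradiction c⇝p c↛p
    functional _ (inj₂ (_ , refl))   (inj₂ (_ , refl))   = refl

    -- Both o and c would be joined to z in G.
    mixed : Marked (G , u) → Marked (H , v) → ¬ Reach G c u → Reach H c v →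
      ¬ addEdge G c u ≡ addEdge (relabel σ H) c (σ v)
    mixed {G = G} {H = H} (F , o⇝z) (F′ , o⇝z′) c↛u c⇝v eq
      with addEdge-injective R′⇒ ⇒R′ Rc F (relabel-forest F′) c↛u (relabel-separates F′ c⇝v) eq
    ... | refl , _ = c↛o F
      (subst₂ (Reach (relabel σ H)) σo≡c σz≡z (Reach-relabel⁺ σσ H o⇝z′) ◅◅ reverse-Reach F o⇝z)

    -- Within one branch of `_∼_` this is `addEdge-injective`, followed in the second branch by
    -- undoing `σ`; `mixed` rules out different branches.
    injective : ∀ {x x′ F} → Marked x → Marked x′ → x ∼ F → x′ ∼ F → x ≡ x′
    injective (F , _) (F′ , _) (inj₁ (c↛p , eq)) (inj₁ (c↛p′ , eq′)) =
      let G≡ , p≡ = addEdge-injective R′⇒ ⇒R′ Rc F F′ c↛p c↛p′ (trans (sym eq) eq′)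
      in cong₂ _,_ G≡ p≡
    injective M M′ (inj₁ (c↛p , eq)) (inj₂ (c⇝p′ , eq′)) =
      contradiction (trans (sym eq) eq′) (mixed M M′ c↛p c⇝p′)
    injective M M′ (inj₂ (c⇝p , eq)) (inj₁ (c↛p′ , eq′)) =
      contradiction (trans (sym eq′) eq) (mixed M′ M c↛p′ c⇝p)
    injective {G , _} {G′ , _} (F , _) (F′ , _) (inj₂ (c⇝p , eq)) (inj₂ (c⇝p′ , eq′)) =
      let G≡ , p≡ = addEdge-injective R′⇒ ⇒R′ Rc (relabel-forest F) (relabel-forest F′)
                      (relabel-separates F c⇝p) (relabel-separates F′ c⇝p′) (trans (sym eq) eq′)
      in cong₂ _,_
           (trans (sym (relabel-involutive σσ G))
             (trans (cong (relabel σ) G≡) (relabel-involutive σσ G′)))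
           (σ-injective σσ p≡)

    cut-bijection : IsBijectionBetween (𝓕[n≺1] n (suc j) ∘ proj₁) (𝓕[n≺1] n j) _∼_
    cut-bijection = record
      { total      = λ M → let F , C , ∼ = total (to marked M) in F , from cut C , ∼
      ; surjective = λ C → let x , M , ∼ = surjective (to cut C) in x , from marked M , ∼
      ; functional = λ {x} → functional x
      ; injective  = λ M M′ → injective (to marked M) (to marked M′)
      }
      where
      marked : 𝓕[n≺1] n (suc j) G ⇔ (IsForest R G × Reach G o z)
      marked = 𝓕[n≺1]⇔Reach (s≤s z≤n)

      cut : 𝓕[n≺1] n j G ⇔ (IsForest R′ G × Reach G o z)
      cut = 𝓕[n≺1]⇔Reach 1≤j

  HasCardinality-pred : ∀ {j} → 1 ≤ j → suc j < n →
    HasCardinality (𝓕[n≺1] n (suc j)) m → HasCardinality (𝓕[n≺1] n j) (n * m)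
  HasCardinality-pred 1≤j j<n =
    -- Unification takes `c` from `toℕ-fromℕ<`: it is the vertex of index `j`.
    HasCardinality-bijection (cut-bijection 1≤j j<n (toℕ-fromℕ< (≤-trans (n≤1+n _) j<n)))
    ∘ HasCardinality-×-Fin

  -- The base case of `n - 1` roots

  emptyGraph : Graph n
  emptyGraph = fromDecidable λ _ _ → no id

  ¬Adj-emptyGraph : ¬ Adj emptyGraph u v
  ¬Adj-emptyGraph {u} {v} = to (Adj-fromDecidable {u = u} {v = v} λ _ _ → no id)

  Reach-emptyGraph : Reach emptyGraph u v → u ≡ v
  Reach-emptyGraph ε       = refl
  Reach-emptyGraph (e ◅ _) = ⊥-elim (¬Adj-emptyGraph e)

  emptyGraph-isForest : IsForest (IsRoot n) emptyGraph
  emptyGraph-isForest = record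
    { symmetric  = ⊥-elim ∘ ¬Adj-emptyGraph
    ; loopless   = ¬Adj-emptyGraph
    ; bridge     = ⊥-elim ∘ ¬Adj-emptyGraph
    ; hasRoot    = λ v → v , toℕ<n v , ε
    ; rootUnique = λ _ _ → Reach-emptyGraph
    }

  -- Only `z` is not a root, so it has to hang directly from `o`. Here `z` plays the part of `c`:
  -- the one forest arises from the edgeless graph, with all vertices as roots, by joining `z` to
  -- `o`.
  HasCardinality-base : ∀ {j} → 1 ≤ j → suc j ≡ n → HasCardinality (𝓕[n≺1] n j) 1
  HasCardinality-base {j} 1≤j j+1≡n =
    K ∷ [] , [] ∷ [] ,
    (λ G → mk⇔ (λ { (here refl) → from char K-valid }) (here ∘ unique ∘ to char)) , refl
    where
    K : Graph n
    K = addEdge emptyGraph z o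

    z≡j : toℕ z ≡ j
    z≡j = suc-injective (trans z≡n (sym j+1≡n))

    oIsRoot : IsRoot j o
    oIsRoot = ≤-trans (≤-reflexive o≡1) 1≤j

    o≢z : o ≢ z
    o≢z = proj₂ (IsRoot-suc z≡j oIsRoot)

    char : 𝓕[n≺1] n j G ⇔ (IsForest (IsRoot j) G × Reach G o z)
    char = 𝓕[n≺1]⇔Reach 1≤j

    K-valid : IsForest (IsRoot j) K × Reach K o z
    K-valid =
      addEdge-isForest (IsRoot-suc z≡j) (IsRoot-pred z≡j) (IsRoot-last z≡j)
        (subst (λ m → IsForest (IsRoot m) emptyGraph) (sym j+1≡n) emptyGraph-isForest)
        (o≢z ∘ sym ∘ Reach-emptyGraph) ,
      from (Adj-addEdge emptyGraph) (inj₂ (inj₂ (refl , refl))) ◅ ε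

    unique : IsForest (IsRoot j) G × Reach G o z → G ≡ K
    unique {G} (F , o⇝z) = Adj-ext {G = G} {H = K} λ u v → mk⇔
      (from (Adj-addEdge emptyGraph) ∘ inj₂ ∘ joins)
      ([ ⊥-elim ∘ ¬Adj-emptyGraph
       , (λ { (inj₁ (refl , refl)) → zo ; (inj₂ (refl , refl)) → symmetric F zo }) ]′
       ∘ to (Adj-addEdge emptyGraph))
      where
      isRoot : v ≢ z → IsRoot j v
      isRoot {v} = IsRoot-pred z≡j (≤-trans (toℕ<n v) (≤-reflexive (sym j+1≡n)))

      neighbour : Adj G z v → v ≢ z → v ≡ o
      neighbour zv v≢z = sym (rootUnique F oIsRoot (isRoot v≢z) (o⇝z ◅◅ zv ◅ ε))

      -- Two distinct roots are never adjacent, so every edge meets `z`, and its other end is a root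
      -- in the tree of `o`.
      joins : Adj G u v → Joins z o u v
      joins {u} {v} uv with u ≟ z | v ≟ z
      ... | yes refl | yes refl = contradiction uv (loopless F)
      ... | yes refl | no v≢z   = inj₁ (refl , neighbour uv v≢z)
      ... | no u≢z   | yes refl = inj₂ (neighbour (symmetric F uv) u≢z , refl)
      ... | no u≢z   | no v≢z with rootUnique F (isRoot u≢z) (isRoot v≢z) (uv ◅ ε)
      ...   | refl = contradiction uv (loopless F)

      zo : Adj G z o
      -- The walk from `o` must enter `z` along some edge, and `joins` leaves only this one.
      zo with findParent F o≢z o⇝z
      ... | d , zd , _ with joins zd
      ...   | inj₁ (_ , refl)   = zd
      ...   | inj₂ (refl , _) = contradiction refl o≢z

  -- Descending induction on the number `j` of roots, with `d` the distance from `j` to `n - 1`.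
  -- Each root removed multiplies the count by `n`, so the value found is the `d`-th power of `n`.
  finite : ∀ d {j} → 1 ≤ j → d + suc j ≡ n → ∃ (HasCardinality (𝓕[n≺1] n j))
  finite zero    1≤j eq = 1 , HasCardinality-base 1≤j eq
  finite (suc d) {j} 1≤j eq =
    let m , card = finite d (s≤s z≤n) (trans (+-suc d (suc j)) eq)
    in n * m , HasCardinality-pred 1≤j
         (≤-trans (m≤n+m _ d) (≤-reflexive (trans (+-suc d (suc j)) eq))) card

theorem2p1 : ∀ (n k : ℕ) → 2 ≤ k → k ≤ n ∸ 1 →
    ∃₂ λ a b → HasCardinality (𝓕[n≺1] n (k ∸ 1)) a ×
    HasCardinality (𝓕[n≺1] n k) b × a ≡ n * b
theorem2p1 (suc n) (suc k) (s≤s 1≤k) k<n =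
  -- There are `suc n` vertices and `suc k` roots here, so the distance to the base case of `n`
  -- roots is `n ∸ suc k`.
  let b , card = finite zero≡1 last≡n (n ∸ suc k) (s≤s z≤n)
        (trans (+-suc (n ∸ suc k) (suc k)) (cong suc (m∸n+n≡m k<n)))
  in suc n * b , b , HasCardinality-pred zero≡1 last≡n 1≤k (s≤s k<n) card , card , refl
  where
  zero≡1 : label {suc n} zero ≡ 1
  zero≡1 = refl

  last≡n : label (fromℕ n) ≡ suc n
  last≡n = cong suc (toℕ-fromℕ n)
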